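{- Let $m\geq 9$ be an integer and let $G$ be a graph with $m$ edges. If $\mu(G)>\sqrt{m}$, then $G$ has a $4$-cycle, i.e. $G$ contains a (not necessarily induced) cycle of length $4$ as a subgraph.
   Context: Graphs are finite, simple and undirected. For a graph $G$, $\mu(G)$ denotes the spectral radius of its adjacency matrix, which is the largest eigenvalue of the adjacency matrix. -}

module Defs where

open import Data.Bool.Base using (Bool; true; false; T; if_then_else_)
open import Data.Bool.Properties using (T?)
open import Data.Fin.Base using (Fin)
import Data.Fin.Base as Fin
import Data.Fin.Properties as Fin
open import Data.Integer.Base using (+_)
open import Data.List.Base using (List; []; _∷_; length; filter; allFin; cartesianProduct)
open import Data.List.Relation.Unary.Unique.Propositional using (Unique)
open import Data.Nat.Base using (ℕ; _⊔_)
import Data.Nat.Base as ℕ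
import Data.Nat.Properties as ℕ
open import Data.Product.Base using (_×_; _,_; ∃-syntax; Σ-syntax; proj₁; proj₂)
open import Data.Rational.Base using (ℚ; 0ℚ; 1ℚ; ½; ∣_∣; Positive; positive; NonNegative)
import Data.Rational.Base as ℚ
import Data.Rational.Properties as ℚ
open import Data.Rational.Solver using (module +-*-Solver)
open import Data.Vec.Functional using (Vector; foldr)
open import Relation.Binary.PropositionalEquality
open import Relation.Nullary.Decidable.Core using (_×-dec_)
open import Relation.Nullary.Negation.Core using (¬_)

-- Reals are Cauchy sequences of rationals with a modulus; the equality is _≃_.

IsCauchy : (ℕ → ℚ) → Set
IsCauchy x = ∀ ε → 0ℚ ℚ.< ε →
  ∃[ N ] ∀ i j → N ℕ.≤ i → N ℕ.≤ j → ∣ x i ℚ.- x j ∣ ℚ.≤ ε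

record ℝ : Set where
  constructor mkℝ
  field
    seq    : ℕ → ℚ
    cauchy : IsCauchy seq

open ℝ public

infix 4 _≃_ _<_ _≤_
infixl 6 _+_
infixl 7 _*_

_≃_ : ℝ → ℝ → Set
x ≃ y = ∀ ε → 0ℚ ℚ.< ε →
  ∃[ N ] ∀ i → N ℕ.≤ i → ∣ seq x i ℚ.- seq y i ∣ ℚ.≤ ε

_<_ : ℝ → ℝ → Set
x < y = ∃[ ε ] 0ℚ ℚ.< ε × ∃[ N ] ∀ i → N ℕ.≤ i → seq x i ℚ.+ ε ℚ.≤ seq y i

_≤_ : ℝ → ℝ → Set
x ≤ y = ¬ (y < x)

fromℚ : ℚ → ℝ
fromℚ q = mkℝ (λ _ → q) λ ε 0<ε → 0 , λ _ _ _ _ →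
  subst (ℚ._≤ ε) (sym (cong ∣_∣ (ℚ.+-inverseʳ q))) (ℚ.<⇒≤ 0<ε)

0ℝ 1ℝ : ℝ
0ℝ = fromℚ 0ℚ
1ℝ = fromℚ 1ℚ

fromℕ : ℕ → ℝ
fromℕ n = fromℚ (+ n ℚ./ 1)

private
  open ℚ.≤-Reasoning

  -- Abstract, so that comparing reals never normalises the Cauchy moduli.
  abstract
    +-cauchy : ∀ {x y} → IsCauchy x → IsCauchy y → IsCauchy (λ i → x i ℚ.+ y i)
    +-cauchy {x} {y} cx cy ε 0<ε = M ⊔ N , bound
      where
      δ : ℚ
      δ = ½ ℚ.* ε

      0<δ : 0ℚ ℚ.< δ
      0<δ = ℚ.positive⁻¹ δ {{ℚ.pos*pos⇒pos ½ ε {{positive 0<ε}}}}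

      M N : ℕ
      M = proj₁ (cx δ 0<δ)
      N = proj₁ (cy δ 0<δ)

      regroup : ∀ a b c d →
        (a ℚ.+ b) ℚ.- (c ℚ.+ d) ≡ (a ℚ.- c) ℚ.+ (b ℚ.- d)
      regroup = solve 4 (λ a b c d →
        (a :+ b) :- (c :+ d) := (a :- c) :+ (b :- d)) refl
        where open +-*-Solver

      bound : ∀ i j → M ⊔ N ℕ.≤ i → M ⊔ N ℕ.≤ j →
              ∣ (x i ℚ.+ y i) ℚ.- (x j ℚ.+ y j) ∣ ℚ.≤ ε
      bound i j i≥ j≥ = begin
        ∣ (x i ℚ.+ y i) ℚ.- (x j ℚ.+ y j) ∣
          ≡⟨ cong ∣_∣ (regroup (x i) (y i) (x j) (y j)) ⟩
        ∣ (x i ℚ.- x j) ℚ.+ (y i ℚ.- y j) ∣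
          ≤⟨ ℚ.∣p+q∣≤∣p∣+∣q∣ (x i ℚ.- x j) (y i ℚ.- y j) ⟩
        ∣ x i ℚ.- x j ∣ ℚ.+ ∣ y i ℚ.- y j ∣
          ≤⟨ ℚ.+-mono-≤
               (proj₂ (cx δ 0<δ) i j (ℕ.m⊔n≤o⇒m≤o M N i≥) (ℕ.m⊔n≤o⇒m≤o M N j≥))
               (proj₂ (cy δ 0<δ) i j (ℕ.m⊔n≤o⇒n≤o M N i≥) (ℕ.m⊔n≤o⇒n≤o M N j≥)) ⟩
        ½ ℚ.* ε ℚ.+ ½ ℚ.* ε
          ≡⟨ ℚ.*-distribʳ-+ ε ½ ½ ⟨
        1ℚ ℚ.* ε
          ≡⟨ ℚ.*-identityˡ ε ⟩
        ε ∎

    eventuallyBounded : ∀ {x} → IsCauchy x →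
      ∃[ B ] Positive B × ∃[ N ] ∀ i → N ℕ.≤ i → ∣ x i ∣ ℚ.≤ B
    eventuallyBounded {x} cx =
      1ℚ ℚ.+ ∣ x N ∣ ,
      ℚ.pos+nonNeg⇒pos 1ℚ ∣ x N ∣ {{ℚ.∣-∣-nonNeg (x N)}} ,
      N , bound
      where
      0<1 : 0ℚ ℚ.< 1ℚ
      0<1 = ℚ.positive⁻¹ 1ℚ

      N : ℕ
      N = proj₁ (cx 1ℚ 0<1)

      split : ∀ a b → a ≡ (a ℚ.- b) ℚ.+ b
      split = solve 2 (λ a b → a := (a :- b) :+ b) refl
        where open +-*-Solver

      bound : ∀ i → N ℕ.≤ i → ∣ x i ∣ ℚ.≤ 1ℚ ℚ.+ ∣ x N ∣
      bound i i≥ = begin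
        ∣ x i ∣                       ≡⟨ cong ∣_∣ (split (x i) (x N)) ⟩
        ∣ (x i ℚ.- x N) ℚ.+ x N ∣     ≤⟨ ℚ.∣p+q∣≤∣p∣+∣q∣ (x i ℚ.- x N) (x N) ⟩
        ∣ x i ℚ.- x N ∣ ℚ.+ ∣ x N ∣   ≤⟨ ℚ.+-monoˡ-≤ ∣ x N ∣
                                           (proj₂ (cx 1ℚ 0<1) i N i≥ ℕ.≤-refl) ⟩
        1ℚ ℚ.+ ∣ x N ∣                ∎

    *-mono-≤-nonNeg : ∀ {p q r s} → NonNegative q → NonNegative r →
                      p ℚ.≤ q → r ℚ.≤ s → p ℚ.* r ℚ.≤ q ℚ.* s
    *-mono-≤-nonNeg {q = q} {r} q≥0 r≥0 p≤q r≤s =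
      ℚ.≤-trans (ℚ.*-monoʳ-≤-nonNeg r {{r≥0}} p≤q) (ℚ.*-monoˡ-≤-nonNeg q {{q≥0}} r≤s)

    divide : ∀ C ε → Positive C → 0ℚ ℚ.< ε → ∃[ δ ] 0ℚ ℚ.< δ × C ℚ.* δ ≡ ε
    divide C ε C>0 0<ε =
      ℚ.1/ C ℚ.* ε ,
      ℚ.positive⁻¹ _ {{ℚ.pos*pos⇒pos (ℚ.1/ C) {{ℚ.1/pos⇒pos C}} ε {{positive 0<ε}}}} ,
      (begin-equality
        C ℚ.* (ℚ.1/ C ℚ.* ε)   ≡⟨ ℚ.*-assoc C (ℚ.1/ C) ε ⟨
        (C ℚ.* ℚ.1/ C) ℚ.* ε   ≡⟨ cong (ℚ._* ε) (ℚ.*-inverseʳ C) ⟩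
        1ℚ ℚ.* ε               ≡⟨ ℚ.*-identityˡ ε ⟩
        ε                      ∎)
      where
      instance
        posC : Positive C
        posC = C>0

        nonZeroC : ℚ.NonZero C
        nonZeroC = ℚ.pos⇒nonZero C

    *-bound : ∀ {A B δ} → NonNegative A → NonNegative δ → ∀ a b c d →
      ∣ a ∣ ℚ.≤ A → ∣ d ∣ ℚ.≤ B → ∣ a ℚ.- c ∣ ℚ.≤ δ → ∣ b ℚ.- d ∣ ℚ.≤ δ →
      ∣ a ℚ.* b ℚ.- c ℚ.* d ∣ ℚ.≤ (A ℚ.+ B) ℚ.* δ
    *-bound {A} {B} {δ} A≥0 δ≥0 a b c d ∣a∣≤A ∣d∣≤B ∣a-c∣≤δ ∣b-d∣≤δ = begin
      ∣ a ℚ.* b ℚ.- c ℚ.* d ∣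
        ≡⟨ cong ∣_∣ (regroup a b c d) ⟩
      ∣ a ℚ.* (b ℚ.- d) ℚ.+ (a ℚ.- c) ℚ.* d ∣
        ≤⟨ ℚ.∣p+q∣≤∣p∣+∣q∣ (a ℚ.* (b ℚ.- d)) ((a ℚ.- c) ℚ.* d) ⟩
      ∣ a ℚ.* (b ℚ.- d) ∣ ℚ.+ ∣ (a ℚ.- c) ℚ.* d ∣
        ≡⟨ cong₂ ℚ._+_ (ℚ.∣p*q∣≡∣p∣*∣q∣ a (b ℚ.- d)) (ℚ.∣p*q∣≡∣p∣*∣q∣ (a ℚ.- c) d) ⟩
      ∣ a ∣ ℚ.* ∣ b ℚ.- d ∣ ℚ.+ ∣ a ℚ.- c ∣ ℚ.* ∣ d ∣
        ≤⟨ ℚ.+-mono-≤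
             (*-mono-≤-nonNeg A≥0 (ℚ.∣-∣-nonNeg (b ℚ.- d)) ∣a∣≤A ∣b-d∣≤δ)
             (*-mono-≤-nonNeg δ≥0 (ℚ.∣-∣-nonNeg d) ∣a-c∣≤δ ∣d∣≤B) ⟩
      A ℚ.* δ ℚ.+ δ ℚ.* B
        ≡⟨ cong (A ℚ.* δ ℚ.+_) (ℚ.*-comm δ B) ⟩
      A ℚ.* δ ℚ.+ B ℚ.* δ
        ≡⟨ ℚ.*-distribʳ-+ δ A B ⟨
      (A ℚ.+ B) ℚ.* δ ∎
      where
      regroup : ∀ a b c d →
        a ℚ.* b ℚ.- c ℚ.* d ≡ a ℚ.* (b ℚ.- d) ℚ.+ (a ℚ.- c) ℚ.* d
      regroup = solve 4 (λ a b c d →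
        a :* b :- c :* d := a :* (b :- d) :+ (a :- c) :* d) refl
        where open +-*-Solver

    *-cauchy : ∀ {x y} → IsCauchy x → IsCauchy y → IsCauchy (λ i → x i ℚ.* y i)
    *-cauchy {x} {y} cx cy ε 0<ε =
      let A , A>0 , K , ∣x∣≤A = eventuallyBounded {x} cx
          B , B>0 , L , ∣y∣≤B = eventuallyBounded {y} cy
          δ , 0<δ , [A+B]δ≡ε  = divide (A ℚ.+ B) ε (ℚ.pos+pos⇒pos A {{A>0}} B {{B>0}}) 0<ε
          M , ∣Δx∣≤δ          = cx δ 0<δ
          N , ∣Δy∣≤δ          = cy δ 0<δ
      in
      (K ⊔ L) ⊔ (M ⊔ N) , λ i j i≥ j≥ →
      let i≥KL = ℕ.m⊔n≤o⇒m≤o (K ⊔ L) (M ⊔ N) i≥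
          j≥KL = ℕ.m⊔n≤o⇒m≤o (K ⊔ L) (M ⊔ N) j≥
          i≥MN = ℕ.m⊔n≤o⇒n≤o (K ⊔ L) (M ⊔ N) i≥
          j≥MN = ℕ.m⊔n≤o⇒n≤o (K ⊔ L) (M ⊔ N) j≥
      in
      subst (∣ x i ℚ.* y i ℚ.- x j ℚ.* y j ∣ ℚ.≤_) [A+B]δ≡ε
        (*-bound (ℚ.pos⇒nonNeg A {{A>0}}) (ℚ.pos⇒nonNeg δ {{positive 0<δ}})
          (x i) (y i) (x j) (y j)
          (∣x∣≤A i (ℕ.m⊔n≤o⇒m≤o K L i≥KL))
          (∣y∣≤B j (ℕ.m⊔n≤o⇒n≤o K L j≥KL))
          (∣Δx∣≤δ i j (ℕ.m⊔n≤o⇒m≤o M N i≥MN) (ℕ.m⊔n≤o⇒m≤o M N j≥MN))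
          (∣Δy∣≤δ i j (ℕ.m⊔n≤o⇒n≤o M N i≥MN) (ℕ.m⊔n≤o⇒n≤o M N j≥MN)))

_+_ : ℝ → ℝ → ℝ
x + y = mkℝ (λ i → seq x i ℚ.+ seq y i) (+-cauchy {seq x} {seq y} (cauchy x) (cauchy y))

_*_ : ℝ → ℝ → ℝ
x * y = mkℝ (λ i → seq x i ℚ.* seq y i) (*-cauchy {seq x} {seq y} (cauchy x) (cauchy y))

-- Square roots and largest eigenvalues are given as relations, each determining
-- its value up to _≃_.

IsSqrt : ℝ → ℝ → Set
IsSqrt r s = 0ℝ ≤ s × s * s ≃ r

∑ : ∀ {n} → Vector ℝ n → ℝ
∑ = foldr _+_ 0ℝ

Matrix : ℕ → Set
Matrix n = Fin n → Fin n → ℝ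

IsEigenvalue : ∀ {n} → Matrix n → ℝ → Set
IsEigenvalue {n} A ν = Σ[ v ∈ Vector ℝ n ]
  ¬ (∀ i → v i ≃ 0ℝ) × (∀ i → ∑ (λ j → A i j * v j) ≃ ν * v i)

IsLargestEigenvalue : ∀ {n} → Matrix n → ℝ → Set
IsLargestEigenvalue A μ = IsEigenvalue A μ × (∀ ν → IsEigenvalue A ν → ν ≤ μ)

record Graph (n : ℕ) : Set where
  field
    adj    : Fin n → Fin n → Bool
    symm   : ∀ i j → adj i j ≡ adj j i
    irrefl : ∀ i → adj i i ≡ false

module _ {n : ℕ} (G : Graph n) where
  open Graph G

  -- Each edge is listed once, with its smaller endpoint first.
  edges : List (Fin n × Fin n)
  edges = filter (λ (i , j) → (i Fin.<? j) ×-dec T? (adj i j))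
                 (cartesianProduct (allFin n) (allFin n))

  numEdges : ℕ
  numEdges = length edges

  adjacencyMatrix : Matrix n
  adjacencyMatrix i j = if adj i j then 1ℝ else 0ℝ

  IsSpectralRadius : ℝ → Set
  IsSpectralRadius = IsLargestEigenvalue adjacencyMatrix

  Has4Cycle : Set
  Has4Cycle = ∃[ a ] ∃[ b ] ∃[ c ] ∃[ d ] Unique (a ∷ b ∷ c ∷ d ∷ []) ×
              T (adj a b) × T (adj b c) × T (adj c d) × T (adj d a)

{-# OPTIONS --safe #-}
module Submission where

-- Suppose G has no 4-cycle and x = |v| for an eigenvector v of μ, so that x ≥ 0 and
-- μ x ≤ A x.  Let x be maximal at u and let c w be the number of common neighbours of
-- u and w, so c w ≤ 1 for w ≠ u.  Put d = deg u and write S, Y for the sums of c w * x w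
-- over the neighbours of u and over the vertices beyond, P for the sum of c over the
-- neighbours and B for the sum of the degrees beyond.  Counting walks of length two
-- from u gives μ² x u ≤ d * x u + S + Y.  From μ ≥ 3 and A x ≥ μ x on the two classes,
--   3 S ≤ P * x u + S + Y   and   3 Y ≤ B * x u,
-- so 2 μ² x u ≤ (2 d + P + B) * x u.  A neighbour w of u has degree at least 1 + c w,
-- hence 2 d + P + B ≤ 2 m and μ² ≤ m.
--
-- All of this is done with the rational terms of the Cauchy sequences at one large
-- index, where A x ≥ q x holds up to an error e for a rational q with m < q² and q ≤ μ.

-- Finite sums of rationals, indicator functions and counting.

module RationalSums where
  open import Algebra.Bundles using (CommutativeRing)
  open import Data.Bool.Base using (Bool; true; false; T; _∧_; if_then_else_)
  open import Data.Fin.Base using (Fin; zero; suc)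
  open import Data.Fin.Properties using (_≟_; suc-injective)
  import Data.Integer.Base as ℤ
  import Data.Integer.Properties as ℤ
  open import Data.List.Base using (List; _∷_; _++_; length; filter; map; tabulate; cartesianProduct)
  open import Data.Nat.Base as ℕ using (ℕ; zero; suc)
  open import Data.Product.Base using (_×_; _,_)
  open import Data.Rational.Base
  open import Data.Rational.Properties hiding (_≟_)
  open import Data.Rational.Unnormalised.Base as ℚᵘ using (mkℚᵘ)
  import Data.Rational.Unnormalised.Properties as ℚᵘ
  open import Data.Rational.Solver using (module +-*-Solver)
  open import Data.Unit.Base using (tt)
  open import Relation.Binary.PropositionalEquality
  open import Relation.Nullary.Decidable.Core using (does)
  open import Relation.Unary using (Decidable)

  open import Algebra.Properties.Semiring.Sum (CommutativeRing.semiring +-*-commutativeRing) public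
    using (sum; sum-cong-≗; sum-replicate-zero; ∑-distrib-+; ∑-comm; *-distribˡ-sum; *-distribʳ-sum)

  *-monoˡ-≤ : ∀ {r p q} → 0ℚ ≤ r → p ≤ q → r * p ≤ r * q
  *-monoˡ-≤ {r} 0≤r = *-monoˡ-≤-nonNeg r {{nonNegative 0≤r}}

  *-monoʳ-≤ : ∀ {r p q} → 0ℚ ≤ r → p ≤ q → p * r ≤ q * r
  *-monoʳ-≤ {r} 0≤r = *-monoʳ-≤-nonNeg r {{nonNegative 0≤r}}

  0≤* : ∀ {p q} → 0ℚ ≤ p → 0ℚ ≤ q → 0ℚ ≤ p * q
  0≤* {p} {q} 0≤p 0≤q = subst (_≤ p * q) (*-zeroʳ p) (*-monoˡ-≤ 0≤p 0≤q)

  p≤p+q : ∀ {p q} → 0ℚ ≤ q → p ≤ p + q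
  p≤p+q {p} {q} 0≤q = subst (_≤ p + q) (+-identityʳ p) (+-monoʳ-≤ p 0≤q)

  +-cancelʳ-≤ : ∀ r {p q} → p + r ≤ q + r → p ≤ q
  +-cancelʳ-≤ r {p} {q} p+r≤q+r =
    subst₂ _≤_ (cancel p r) (cancel q r) (+-monoˡ-≤ (- r) p+r≤q+r)
    where
    open +-*-Solver
    cancel : ∀ p r → (p + r) + - r ≡ p
    cancel = solve 2 (λ p r → (p :+ r) :+ :- r := p) refl

  sum-mono-≤ : ∀ {n} {f g : Fin n → ℚ} → (∀ i → f i ≤ g i) → sum f ≤ sum g
  sum-mono-≤ {zero}  f≤g = ≤-refl
  sum-mono-≤ {suc n} f≤g = +-mono-≤ (f≤g zero) (sum-mono-≤ (λ i → f≤g (suc i)))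

  sum-zero : ∀ {n} {f : Fin n → ℚ} → (∀ i → f i ≡ 0ℚ) → sum f ≡ 0ℚ
  sum-zero {n} f≡0 = trans (sum-cong-≗ f≡0) (sum-replicate-zero n)

  0≤sum : ∀ {n} {f : Fin n → ℚ} → (∀ i → 0ℚ ≤ f i) → 0ℚ ≤ sum f
  0≤sum {n} {f} 0≤f = subst (_≤ sum f) (sum-zero {n} (λ _ → refl)) (sum-mono-≤ 0≤f)

  sum-linear : ∀ {n} (g h x : Fin n → ℚ) →
    sum (λ i → (g i + h i) * x i) ≡ sum (λ i → g i * x i) + sum (λ i → h i * x i)
  sum-linear g h x = trans
    (sum-cong-≗ (λ i → *-distribʳ-+ (x i) (g i) (h i)))
    (∑-distrib-+ (λ i → g i * x i) (λ i → h i * x i))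

  -- Interchanging the two sums moves the matrix from the vector to the weights. With an adjacency
  -- matrix, a weighted sum of entries of `A x` becomes a count of walks sorted by their endpoint.
  sum-transpose : ∀ {m n} (g : Fin m → ℚ) (a : Fin m → Fin n → ℚ) (x : Fin n → ℚ) →
    sum (λ i → g i * sum (λ j → a i j * x j)) ≡ sum (λ j → sum (λ i → g i * a i j) * x j)
  sum-transpose g a x = begin
    sum (λ i → g i * sum (λ j → a i j * x j))
      ≡⟨ sum-cong-≗ (λ i → *-distribˡ-sum (g i) (λ j → a i j * x j)) ⟩
    sum (λ i → sum (λ j → g i * (a i j * x j)))
      ≡⟨ ∑-comm (λ i j → g i * (a i j * x j)) ⟩
    sum (λ j → sum (λ i → g i * (a i j * x j)))
      ≡⟨ sum-cong-≗ (λ j → sum-cong-≗ (λ i → *-assoc (g i) (a i j) (x j))) ⟨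
    sum (λ j → sum (λ i → g i * a i j * x j))
      ≡⟨ sum-cong-≗ (λ j → *-distribʳ-sum (x j) (λ i → g i * a i j)) ⟨
    sum (λ j → sum (λ i → g i * a i j) * x j) ∎
    where open ≡-Reasoning

  ⟦_⟧ : Bool → ℚ
  ⟦ b ⟧ = if b then 1ℚ else 0ℚ

  0≤1 : 0ℚ ≤ 1ℚ
  0≤1 = ≤ᵇ⇒≤ tt

  0≤⟦_⟧ : ∀ b → 0ℚ ≤ ⟦ b ⟧
  0≤⟦ true ⟧  = 0≤1
  0≤⟦ false ⟧ = ≤-refl

  ⟦_⟧≤1 : ∀ b → ⟦ b ⟧ ≤ 1ℚ
  ⟦ true ⟧≤1  = ≤-refl
  ⟦ false ⟧≤1 = 0≤1

  ⟦⟧-∧ : ∀ b c → ⟦ b ⟧ * ⟦ c ⟧ ≡ ⟦ b ∧ c ⟧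
  ⟦⟧-∧ true  c = *-identityˡ ⟦ c ⟧
  ⟦⟧-∧ false c = *-zeroˡ ⟦ c ⟧

  ⟦⟧*-mono-≤ : ∀ b {p q} → (T b → p ≤ q) → ⟦ b ⟧ * p ≤ ⟦ b ⟧ * q
  ⟦⟧*-mono-≤ true          p≤q = *-monoˡ-≤ 0≤1 (p≤q tt)
  ⟦⟧*-mono-≤ false {p} {q} p≤q = ≤-reflexive (trans (*-zeroˡ p) (sym (*-zeroˡ q)))

  sum-point : ∀ {n} (u : Fin n) (f : Fin n → ℚ) →
    sum (λ w → ⟦ does (u ≟ w) ⟧ * f w) ≡ f u
  sum-point zero f = trans
    (cong₂ _+_ (*-identityˡ (f zero)) (sum-zero (λ w → *-zeroˡ (f (suc w)))))
    (+-identityʳ (f zero))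
  sum-point (suc u) f = trans
    (cong₂ _+_ (*-zeroˡ (f zero)) (sum-point u (λ w → f (suc w))))
    (+-identityˡ (f (suc u)))

  -- Once `β zero` holds, uniqueness forces every later indicator to vanish; otherwise the tail
  -- inherits the hypothesis.
  sum-⟦⟧≤1 : ∀ {n} (β : Fin n → Bool) → (∀ i j → T (β i) → T (β j) → i ≡ j) →
    sum (λ i → ⟦ β i ⟧) ≤ 1ℚ
  sum-⟦⟧≤1 {zero}  β unique = 0≤1
  sum-⟦⟧≤1 {suc n} β unique with β zero in β₀
  ... | true  = ≤-reflexive (trans (cong (1ℚ +_) (sum-zero rest)) (+-identityʳ 1ℚ))
    where
    rest : ∀ i → ⟦ β (suc i) ⟧ ≡ 0ℚ
    rest i with β (suc i) in βᵢ
    ... | false = refl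
    ... | true with () ← unique zero (suc i) (subst T (sym β₀) tt) (subst T (sym βᵢ) tt)
  ... | false = subst (_≤ 1ℚ) (sym (+-identityˡ _))
    (sum-⟦⟧≤1 (λ i → β (suc i)) (λ i j βi βj → suc-injective (unique (suc i) (suc j) βi βj)))

  ι : ℕ → ℚ
  ι n = ℤ.+ n / 1

  -- Since `_/_` reduces to lowest terms, neither side computes for variable `m` and `n`. The
  -- equation is therefore moved to unnormalised rationals, where all denominators are 1 and only
  -- the factors 1 from cross-multiplication have to be removed.
  ι-+ : ∀ m n → ι (m ℕ.+ n) ≡ ι m + ι n
  ι-+ m n = toℚᵘ-injective (begin
    toℚᵘ (ι (m ℕ.+ n))
      ≈⟨ toℚᵘ-fromℚᵘ (mkℚᵘ (ℤ.+ (m ℕ.+ n)) 0) ⟩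
    mkℚᵘ (ℤ.+ (m ℕ.+ n)) 0
      ≈⟨ ℚᵘ.*≡* (cong₂ (λ i j → (i ℤ.+ j) ℤ.* ℤ.1ℤ)
           (sym (ℤ.*-identityʳ (ℤ.+ m))) (sym (ℤ.*-identityʳ (ℤ.+ n)))) ⟩
    mkℚᵘ (ℤ.+ m) 0 ℚᵘ.+ mkℚᵘ (ℤ.+ n) 0
      ≈⟨ ℚᵘ.+-cong (toℚᵘ-fromℚᵘ (mkℚᵘ (ℤ.+ m) 0)) (toℚᵘ-fromℚᵘ (mkℚᵘ (ℤ.+ n) 0)) ⟨
    toℚᵘ (ι m) ℚᵘ.+ toℚᵘ (ι n)
      ≈⟨ toℚᵘ-homo-+ (ι m) (ι n) ⟨
    toℚᵘ (ι m + ι n) ∎)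
    where
    open import Relation.Binary.Reasoning.Setoid ℚᵘ.≃-setoid

  0≤ι : ∀ n → 0ℚ ≤ ι n
  0≤ι n = nonNegative⁻¹ (ι n) {{normalize-nonNeg n 1}}

  module _ {A : Set} {P : A → Set} (P? : Decidable P) where

    count : List A → ℚ
    count xs = ι (length (filter P? xs))

    count-∷ : ∀ x xs → count (x ∷ xs) ≡ ⟦ does (P? x) ⟧ + count xs
    count-∷ x xs with does (P? x)
    ... | true  = ι-+ 1 (length (filter P? xs))
    ... | false = sym (+-identityˡ (count xs))

    -- The list has the shape to which `cartesianProduct` unfolds: one row, followed by the
    -- remaining rows `ys`.
    count-map-tabulate-++ : ∀ {B : Set} {n} (h : B → A) (g : Fin n → B) ys →
      count (map h (tabulate g) ++ ys) ≡ sum (λ j → ⟦ does (P? (h (g j))) ⟧) + count ys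
    count-map-tabulate-++ {n = zero}  h g ys = sym (+-identityˡ (count ys))
    count-map-tabulate-++ {n = suc n} h g ys = begin
      count (h (g zero) ∷ xs ++ ys)                ≡⟨ count-∷ (h (g zero)) (xs ++ ys) ⟩
      χ₀ + count (xs ++ ys)                        ≡⟨ cong (χ₀ +_) (count-map-tabulate-++ h (λ j → g (suc j)) ys) ⟩
      χ₀ + (Σχ + count ys)                         ≡⟨ +-assoc χ₀ Σχ (count ys) ⟨
      χ₀ + Σχ + count ys                           ∎
      where
      open ≡-Reasoning
      Σχ = sum (λ j → ⟦ does (P? (h (g (suc j)))) ⟧)
      χ₀ = ⟦ does (P? (h (g zero))) ⟧
      xs = map h (tabulate (λ j → g (suc j)))

  count-cartesianProduct : ∀ {A B : Set} {P : A × B → Set} (P? : Decidable P)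
    {m n} (f : Fin m → A) (g : Fin n → B) →
    ι (length (filter P? (cartesianProduct (tabulate f) (tabulate g)))) ≡
    sum (λ i → sum (λ j → ⟦ does (P? (f i , g j)) ⟧))
  count-cartesianProduct P? {zero}  f g = refl
  count-cartesianProduct P? {suc m} f g = trans
    (count-map-tabulate-++ P? (f zero ,_) g (cartesianProduct (tabulate (λ i → f (suc i))) (tabulate g)))
    (cong (sum (λ j → ⟦ does (P? (f zero , g j)) ⟧) +_) (count-cartesianProduct P? (λ i → f (suc i)) g))

-- Degrees and codegrees in a graph without 4-cycles.

module C₄Free where
  open import Data.Bool.Base using (Bool; true; false; T; not; _∧_)
  open import Data.Bool.Properties using (T?; T-∧)
  open import Data.Fin.Base using (Fin)
  import Data.Fin.Base as Fin
  open import Data.Fin.Properties using (_≟_; <-cmp)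
  import Data.Fin.Properties as Fin
  open import Data.List.Relation.Unary.All using ([]; _∷_)
  open import Data.List.Relation.Unary.AllPairs as AllPairs using ([]; _∷_)
  open import Data.Nat.Base using (ℕ)
  open import Data.Product.Base using (_,_)
  open import Data.Rational.Base
  open import Data.Rational.Properties hiding (_≟_; <-cmp)
  open import Data.Rational.Solver using (module +-*-Solver)
  open import Defs using (Graph; Has4Cycle; numEdges)
  open import Function.Bundles using (module Equivalence)
  open import Relation.Binary.Definitions using (tri<; tri≈; tri>)
  open import Relation.Binary.PropositionalEquality
  open import Relation.Nullary.Decidable.Core using (Dec; yes; no; does; _×-dec_; ¬?)
  open import Relation.Nullary.Decidable using (dec-true; dec-false)
  open import Relation.Nullary.Negation.Core using (¬_; contradiction)
  open RationalSums

  -- The argument only refutes the absence of a 4-cycle; a finite search turns this refutation into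
  -- an actual cycle.
  has4Cycle? : ∀ {n} (G : Graph n) → Dec (Has4Cycle G)
  has4Cycle? G = Fin.any? λ a → Fin.any? λ b → Fin.any? λ c → Fin.any? λ d →
    AllPairs.allPairs? (λ i j → ¬? (i ≟ j)) _
      ×-dec T? (adj a b) ×-dec T? (adj b c) ×-dec T? (adj c d) ×-dec T? (adj d a)
    where open Graph G

  module _ {n : ℕ} (G : Graph n) where
    open Graph G

    a : Fin n → Fin n → ℚ
    a i j = ⟦ adj i j ⟧

    degree : Fin n → ℚ
    degree i = sum (a i)

    adj-sym : ∀ i j → T (adj i j) → T (adj j i)
    adj-sym i j = subst T (symm i j)

    adj⇒≢ : ∀ i j → T (adj i j) → i ≢ j
    adj⇒≢ i .i i~i refl = subst T (irrefl i) i~i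

    T⇒a≡1 : ∀ i j → T (adj i j) → a i j ≡ 1ℚ
    T⇒a≡1 i j i~j with true ← adj i j = refl

    -- The edge list keeps each edge in one orientation only. Adding the count to itself with the
    -- two indices exchanged restores both orientations, and hence the full adjacency matrix.
    handshake : ι (numEdges G) + ι (numEdges G) ≡ sum degree
    handshake = begin
      ι (numEdges G) + ι (numEdges G)
        -- `allFin n` is a `tabulate` of the identity, and `does` of the conjunction unfolds to the
        -- Boolean in `up`.
        ≡⟨ cong (λ e → e + e) (count-cartesianProduct
              (λ (i , j) → (i Fin.<? j) ×-dec T? (adj i j)) (λ i → i) (λ j → j)) ⟩
      sum (λ i → sum (up i)) + sum (λ i → sum (up i))
        ≡⟨ cong (sum (λ i → sum (up i)) +_) (∑-comm up) ⟩
      sum (λ i → sum (up i)) + sum (λ i → sum (λ j → up j i))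
        ≡⟨ ∑-distrib-+ (λ i → sum (up i)) (λ i → sum (λ j → up j i)) ⟨
      sum (λ i → sum (up i) + sum (λ j → up j i))
        ≡⟨ sum-cong-≗ (λ i → ∑-distrib-+ (up i) (λ j → up j i)) ⟨
      sum (λ i → sum (λ j → up i j + up j i))
        ≡⟨ sum-cong-≗ (λ i → sum-cong-≗ (up+up≡a i)) ⟩
      sum degree ∎
      where
      open ≡-Reasoning

      up : Fin n → Fin n → ℚ
      up i j = ⟦ does (i Fin.<? j) ∧ adj i j ⟧

      up+up≡a : ∀ i j → up i j + up j i ≡ a i j
      up+up≡a i j with <-cmp i j
      ... | tri< i<j _ j≮i
        rewrite dec-true (i Fin.<? j) i<j | dec-false (j Fin.<? i) j≮i = +-identityʳ (a i j)
      ... | tri≈ i≮i refl _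
        rewrite dec-false (i Fin.<? i) i≮i | irrefl i = refl
      ... | tri> i≮j _ j<i
        rewrite dec-false (i Fin.<? j) i≮j | dec-true (j Fin.<? i) j<i =
        trans (+-identityˡ (a j i)) (cong ⟦_⟧ (symm j i))

    -- This is the entry of the squared adjacency matrix at `u` and `w`: the number of walks of
    -- length two between them.
    codegree : Fin n → Fin n → ℚ
    codegree u w = sum (λ v → a u v * a v w)

    0≤codegree : ∀ u w → 0ℚ ≤ codegree u w
    0≤codegree u w = 0≤sum (λ v → 0≤* 0≤⟦ adj u v ⟧ 0≤⟦ adj v w ⟧)

    codegree-refl : ∀ u → codegree u u ≡ degree u
    codegree-refl u = sum-cong-≗ a²≡a
      where
      a²≡a : ∀ v → a u v * a v u ≡ a u v
      a²≡a v rewrite symm v u with adj u v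
      ... | true  = refl
      ... | false = refl

    -- Two distinct common neighbours `v` and `v′` would close the cycle `u`, `v`, `w`, `v′`.
    codegree≤1 : ¬ Has4Cycle G → ∀ u w → u ≢ w → codegree u w ≤ 1ℚ
    codegree≤1 noC₄ u w u≢w = ≤-trans
      (≤-reflexive (sum-cong-≗ (λ v → ⟦⟧-∧ (adj u v) (adj v w))))
      (sum-⟦⟧≤1 (λ v → adj u v ∧ adj v w) unique)
      where
      unique : ∀ v v′ → T (adj u v ∧ adj v w) → T (adj u v′ ∧ adj v′ w) → v ≡ v′
      unique v v′ p p′ with v ≟ v′
      ... | yes v≡v′ = v≡v′
      ... | no v≢v′ =
        let u~v , v~w = Equivalence.to (T-∧ {adj u v}) p
            u~v′ , v′~w = Equivalence.to (T-∧ {adj u v′}) p′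
            w~v′ = adj-sym v′ w v′~w
            v′~u = adj-sym u v′ u~v′
        in contradiction
          (u , v , w , v′ ,
            (adj⇒≢ u v u~v ∷ u≢w ∷ adj⇒≢ u v′ u~v′ ∷ [])
            ∷ (adj⇒≢ v w v~w ∷ v≢v′ ∷ []) ∷ (adj⇒≢ w v′ w~v′ ∷ []) ∷ [] ∷ [] ,
            u~v , v~w , w~v′ , v′~u)
          noC₄

    -- Sums over the vertices are split into u, its neighbours and the vertices beyond;
    -- near and far are the codegrees with u supported on the last two classes.
    module _ (u : Fin n) where

      at : Fin n → ℚ
      at w = ⟦ does (u ≟ w) ⟧

      beyond : Fin n → Bool
      beyond w = not (does (u ≟ w)) ∧ not (adj u w)

      partition : ∀ w → at w + (a u w + ⟦ beyond w ⟧) ≡ 1ℚ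
      partition w with u ≟ w
      ... | yes refl rewrite irrefl u = refl
      ... | no _ with adj u w
      ...   | true  = refl
      ...   | false = refl

      near far : Fin n → ℚ
      near w = a u w * codegree u w
      far w = ⟦ beyond w ⟧ * codegree u w

      0≤near : ∀ w → 0ℚ ≤ near w
      0≤near w = 0≤* 0≤⟦ adj u w ⟧ (0≤codegree u w)

      0≤far : ∀ w → 0ℚ ≤ far w
      0≤far w = 0≤* 0≤⟦ beyond w ⟧ (0≤codegree u w)

      split : ∀ (f : Fin n → ℚ) →
        sum f ≡ f u + (sum (λ w → a u w * f w) + sum (λ w → ⟦ beyond w ⟧ * f w))
      split f = begin
        sum f
          ≡⟨ sum-cong-≗ (λ w → trans (sym (*-identityˡ (f w))) (cong (_* f w) (sym (partition w)))) ⟩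
        sum (λ w → (at w + (a u w + ⟦ beyond w ⟧)) * f w)
          ≡⟨ sum-linear at (λ w → a u w + ⟦ beyond w ⟧) f ⟩
        sum (λ w → at w * f w) + sum (λ w → (a u w + ⟦ beyond w ⟧) * f w)
          ≡⟨ cong₂ _+_ (sum-point u f) (sum-linear (a u) (λ w → ⟦ beyond w ⟧) f) ⟩
        f u + (sum (λ w → a u w * f w) + sum (λ w → ⟦ beyond w ⟧ * f w)) ∎
        where open ≡-Reasoning

      -- The neighbours of `i` include `u` itself and the common neighbours of `u` and `i`. Nothing
      -- is counted twice, because `u` is not adjacent to itself.
      1+codegree≤degree : ∀ i → T (adj u i) → 1ℚ + codegree u i ≤ degree i
      1+codegree≤degree i u~i = begin
        1ℚ + codegree u i
          ≡⟨ cong (_+ codegree u i) (sum-point u (λ _ → 1ℚ)) ⟨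
        sum (λ w → at w * 1ℚ) + codegree u i
          ≡⟨ ∑-distrib-+ (λ w → at w * 1ℚ) (λ w → a u w * a w i) ⟨
        sum (λ w → at w * 1ℚ + a u w * a w i)
          ≤⟨ sum-mono-≤ pointwise ⟩
        degree i ∎
        where
        open ≤-Reasoning
        pointwise : ∀ w → at w * 1ℚ + a u w * a w i ≤ a i w
        pointwise w with u ≟ w
        ... | yes refl rewrite irrefl u = begin
          1ℚ + 0ℚ * a u i   ≡⟨ cong (1ℚ +_) (*-zeroˡ (a u i)) ⟩
          1ℚ                ≡⟨ T⇒a≡1 i u (adj-sym u i u~i) ⟨
          a i u             ∎
        ... | no _ = begin
          0ℚ + a u w * a w i   ≡⟨ +-identityˡ (a u w * a w i) ⟩
          a u w * a w i        ≤⟨ *-monoʳ-≤ 0≤⟦ adj w i ⟧ ⟦ adj u w ⟧≤1 ⟩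
          1ℚ * a w i           ≡⟨ *-identityˡ (a w i) ⟩
          a w i                ≡⟨ cong ⟦_⟧ (symm w i) ⟩
          a i w                ∎

      -- `degree u` occurs twice: once as the degree of `u`, and once as the sum of the ones in
      -- `1+codegree≤degree` over the neighbours of `u`.
      degrees-≥ : degree u + ((degree u + sum near) + sum (λ w → ⟦ beyond w ⟧ * degree w)) ≤ sum degree
      degrees-≥ = begin
        degree u + ((degree u + sum near) + B)
          ≡⟨ cong (λ e → degree u + (e + B)) (∑-distrib-+ (a u) near) ⟨
        degree u + (sum (λ i → a u i + near i) + B)
          ≤⟨ +-monoʳ-≤ (degree u) (+-monoˡ-≤ B (sum-mono-≤ pointwise)) ⟩
        degree u + (sum (λ i → a u i * degree i) + B)
          ≡⟨ split degree ⟨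
        sum degree ∎
        where
        open ≤-Reasoning
        B = sum (λ w → ⟦ beyond w ⟧ * degree w)
        pointwise : ∀ i → a u i + near i ≤ a u i * degree i
        pointwise i = begin
          a u i + near i                ≡⟨ cong (_+ near i) (*-identityʳ (a u i)) ⟨
          a u i * 1ℚ + near i           ≡⟨ *-distribˡ-+ (a u i) 1ℚ (codegree u i) ⟨
          a u i * (1ℚ + codegree u i)   ≤⟨ ⟦⟧*-mono-≤ (adj u i) (1+codegree≤degree i) ⟩
          a u i * degree i              ∎

      module _ (noC₄ : ¬ Has4Cycle G) where

        near≤a : ∀ w → near w ≤ a u w
        near≤a w = ≤-trans
          (⟦⟧*-mono-≤ (adj u w) (λ u~w → codegree≤1 noC₄ u w (adj⇒≢ u w u~w)))
          (≤-reflexive (*-identityʳ (a u w)))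

        far≤beyond : ∀ w → far w ≤ ⟦ beyond w ⟧
        far≤beyond w = ≤-trans
          (⟦⟧*-mono-≤ (beyond w) (λ b → codegree≤1 noC₄ u w (u≢ b)))
          (≤-reflexive (*-identityʳ ⟦ beyond w ⟧))
          where
          u≢ : T (beyond w) → u ≢ w
          u≢ b with no u≢w ← u ≟ w = u≢w

        -- A step back to `u` carries at most the total weight `sum near`. For any other `w`,
        -- `near≤a` bounds the left side by `codegree u w`, which is `near w + far w` because `w`
        -- lies in exactly one of the two classes.
        near-step : ∀ w → sum (λ v → near v * a v w) ≤ at w * sum near + (near w + far w)
        -- Abstracting `partition w` together with `u ≟ w` makes its type reduce as well; in the
        -- second case it then says that the indicators of the two remaining classes add up to 1.
        near-step w with u ≟ w | partition w
        ... | yes refl | _ = begin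
          sum (λ v → near v * a v u)
            ≤⟨ sum-mono-≤ (λ v → *-monoˡ-≤ (0≤near v) ⟦ adj v u ⟧≤1) ⟩
          sum (λ v → near v * 1ℚ)
            ≡⟨ sum-cong-≗ (λ v → *-identityʳ (near v)) ⟩
          sum near
            ≡⟨ *-identityˡ (sum near) ⟨
          1ℚ * sum near
            ≤⟨ p≤p+q (+-mono-≤ (0≤near u) (0≤* ≤-refl (0≤codegree u u))) ⟩
          1ℚ * sum near + (near u + 0ℚ * codegree u u) ∎
          where open ≤-Reasoning
        ... | no _ | p+b≡1 = begin
          sum (λ v → near v * a v w)
            ≤⟨ sum-mono-≤ (λ v → *-monoʳ-≤ 0≤⟦ adj v w ⟧ (near≤a v)) ⟩
          codegree u w
            ≡⟨ *-identityˡ (codegree u w) ⟨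
          1ℚ * codegree u w
            ≡⟨ cong (_* codegree u w) (trans (sym (+-identityˡ (a u w + ⟦ not (adj u w) ⟧))) p+b≡1) ⟨
          (a u w + ⟦ not (adj u w) ⟧) * codegree u w
            ≡⟨ *-distribʳ-+ (codegree u w) (a u w) ⟦ not (adj u w) ⟧ ⟩
          near w + ⟦ not (adj u w) ⟧ * codegree u w
            ≡⟨ +-identityˡ (near w + ⟦ not (adj u w) ⟧ * codegree u w) ⟨
          0ℚ + (near w + ⟦ not (adj u w) ⟧ * codegree u w)
            ≡⟨ cong (_+ (near w + ⟦ not (adj u w) ⟧ * codegree u w)) (*-zeroˡ (sum near)) ⟨
          0ℚ * sum near + (near w + ⟦ not (adj u w) ⟧ * codegree u w) ∎
          where open ≤-Reasoning

        -- Inequalities for an approximate sub-eigenvector at its maximal entry.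

        module _ (x : Fin n → ℚ) (0≤x : ∀ i → 0ℚ ≤ x i) (x≤xᵤ : ∀ i → x i ≤ x u)
                 (q e : ℚ) (3≤q : ι 3 ≤ q) (0≤e : 0ℚ ≤ e)
                 (sub : ∀ i → q * x i ≤ sum (λ j → a i j * x j) + e) where

          private
            X d N P B S Y : ℚ
            X = x u
            d = degree u
            N = sum {n} (λ _ → 1ℚ)
            P = sum near
            B = sum (λ w → ⟦ beyond w ⟧ * degree w)
            S = sum (λ w → near w * x w)
            Y = sum (λ w → far w * x w)

            Ax : Fin n → ℚ
            Ax i = sum (λ j → a i j * x j)

            0≤q : 0ℚ ≤ q
            0≤q = ≤-trans (0≤ι 3) 3≤q

            *e-mono : ∀ {f : Fin n → ℚ} → (∀ i → f i ≤ 1ℚ) → sum f * e ≤ N * e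
            *e-mono f≤1 = *-monoʳ-≤ 0≤e (sum-mono-≤ f≤1)

            -- Adding the hypotheses `sub i` with weights `g i` costs an error `sum g * e`. All
            -- weights used below are at most 1, so `*e-mono` bounds this error by `N * e`, with `N`
            -- the number of vertices.
            weighted : ∀ (g : Fin n → ℚ) → (∀ i → 0ℚ ≤ g i) →
              q * sum (λ i → g i * x i) ≤ sum (λ i → g i * Ax i) + sum g * e
            weighted g 0≤g = begin
              q * sum (λ i → g i * x i)
                ≡⟨ *-distribˡ-sum q (λ i → g i * x i) ⟩
              sum (λ i → q * (g i * x i))
                ≡⟨ sum-cong-≗ (λ i → swap q (g i) (x i)) ⟩
              sum (λ i → g i * (q * x i))
                ≤⟨ sum-mono-≤ (λ i → *-monoˡ-≤ (0≤g i) (sub i)) ⟩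
              sum (λ i → g i * (Ax i + e))
                ≡⟨ sum-cong-≗ (λ i → *-distribˡ-+ (g i) (Ax i) e) ⟩
              sum (λ i → g i * Ax i + g i * e)
                ≡⟨ ∑-distrib-+ (λ i → g i * Ax i) (λ i → g i * e) ⟩
              sum (λ i → g i * Ax i) + sum (λ i → g i * e)
                ≡⟨ cong (sum (λ i → g i * Ax i) +_) (*-distribʳ-sum e g) ⟨
              sum (λ i → g i * Ax i) + sum g * e ∎
              where
              open ≤-Reasoning
              swap : ∀ q g x → q * (g * x) ≡ g * (q * x)
              swap = solve 3 (λ q g x → q :* (g :* x) := g :* (q :* x)) refl
                where open +-*-Solver

            triple : ∀ {p} → 0ℚ ≤ p → p + p + p ≤ q * p
            triple {p} 0≤p = ≤-trans (≤-reflexive (three* p)) (*-monoʳ-≤ 0≤p 3≤q)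
              where
              open +-*-Solver
              three* : ∀ p → p + p + p ≡ ι 3 * p
              three* = solve 1 (λ p → p :+ p :+ p := con (ι 3) :* p) refl

            -- Walks of length two from `u` are sorted by endpoint. Those returning to `u` number
            -- `codegree u u`, which is the degree.
            two-steps : sum (λ i → a u i * Ax i) ≡ d * X + (S + Y)
            two-steps = begin
              sum (λ i → a u i * Ax i)
                ≡⟨ sum-transpose (a u) a x ⟩
              sum (λ w → codegree u w * x w)
                ≡⟨ split (λ w → codegree u w * x w) ⟩
              codegree u u * X +
                (sum (λ w → a u w * (codegree u w * x w)) +
                 sum (λ w → ⟦ beyond w ⟧ * (codegree u w * x w)))
                ≡⟨ cong₂ _+_ (cong (_* X) (sym (codegree-refl u))) (cong₂ _+_
                     (sum-cong-≗ (λ w → *-assoc (a u w) (codegree u w) (x w)))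
                     (sum-cong-≗ (λ w → *-assoc ⟦ beyond w ⟧ (codegree u w) (x w)))) ⟨
              d * X + (S + Y) ∎
              where open ≡-Reasoning

            -- `sub` is applied twice: at `u`, where multiplying by `q` leaves the error `q * e`,
            -- and then at the neighbours of `u`, where the error is at most `N * e`.
            centre-bound : q * q * X ≤ (d * X + (S + Y)) + (N + q) * e
            centre-bound = begin
              q * q * X
                ≡⟨ *-assoc q q X ⟩
              q * (q * X)
                ≤⟨ *-monoˡ-≤ 0≤q (sub u) ⟩
              q * (Ax u + e)
                ≡⟨ *-distribˡ-+ q (Ax u) e ⟩
              q * Ax u + q * e
                ≤⟨ +-monoˡ-≤ (q * e) (weighted (a u) (λ i → 0≤⟦ adj u i ⟧)) ⟩
              (sum (λ i → a u i * Ax i) + d * e) + q * e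
                ≤⟨ +-monoˡ-≤ (q * e) (+-mono-≤ (≤-reflexive two-steps) (*e-mono (λ i → ⟦ adj u i ⟧≤1))) ⟩
              ((d * X + (S + Y)) + N * e) + q * e
                ≡⟨ +-assoc (d * X + (S + Y)) (N * e) (q * e) ⟩
              (d * X + (S + Y)) + (N * e + q * e)
                ≡⟨ cong (d * X + (S + Y) +_) (*-distribʳ-+ e N q) ⟨
              (d * X + (S + Y)) + (N + q) * e ∎
              where open ≤-Reasoning

            -- The weights `near` are pushed one step along the edges by `near-step`: the part
            -- returning to `u` gives `P * X`, the rest gives `S + Y`. The factor three comes from
            -- `3≤q`.
            near-bound : S + S + S ≤ (P * X + (S + Y)) + N * e
            near-bound = begin
              S + S + S
                ≤⟨ triple (0≤sum (λ w → 0≤* (0≤near w) (0≤x w))) ⟩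
              q * S
                ≤⟨ weighted near 0≤near ⟩
              sum (λ i → near i * Ax i) + P * e
                ≤⟨ +-mono-≤ steps (*e-mono (λ i → ≤-trans (near≤a i) ⟦ adj u i ⟧≤1)) ⟩
              (P * X + (S + Y)) + N * e ∎
              where
              open ≤-Reasoning
              steps : sum (λ i → near i * Ax i) ≤ P * X + (S + Y)
              steps = begin
                sum (λ i → near i * Ax i)
                  ≡⟨ sum-transpose near a x ⟩
                sum (λ w → sum (λ v → near v * a v w) * x w)
                  ≤⟨ sum-mono-≤ (λ w → *-monoʳ-≤ (0≤x w) (near-step w)) ⟩
                sum (λ w → (at w * P + (near w + far w)) * x w)
                  ≡⟨ sum-linear (λ w → at w * P) (λ w → near w + far w) x ⟩
                sum (λ w → at w * P * x w) + sum (λ w → (near w + far w) * x w)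
                  ≡⟨ cong₂ _+_ (trans
                       (sum-cong-≗ (λ w → *-assoc (at w) P (x w)))
                       (sum-point u (λ w → P * x w)))
                       (sum-linear near far x) ⟩
                P * X + (S + Y) ∎

            -- Beyond the neighbours a crude bound is enough: `far` is at most 1 there, and every
            -- term of `Ax i` is replaced by its largest possible value, giving `degree i * X`.
            far-bound : Y + Y + Y ≤ B * X + N * e
            far-bound = begin
              Y + Y + Y
                ≤⟨ triple (0≤sum (λ w → 0≤* (0≤far w) (0≤x w))) ⟩
              q * Y
                ≤⟨ weighted far 0≤far ⟩
              sum (λ i → far i * Ax i) + sum far * e
                ≤⟨ +-mono-≤ (sum-mono-≤ pointwise)
                     (*e-mono (λ i → ≤-trans (far≤beyond i) ⟦ beyond i ⟧≤1)) ⟩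
              sum (λ i → ⟦ beyond i ⟧ * degree i * X) + N * e
                ≡⟨ cong (_+ N * e) (*-distribʳ-sum X (λ i → ⟦ beyond i ⟧ * degree i)) ⟨
              B * X + N * e ∎
              where
              open ≤-Reasoning
              Ax≤ : ∀ i → Ax i ≤ degree i * X
              Ax≤ i = ≤-trans
                (sum-mono-≤ (λ j → *-monoˡ-≤ 0≤⟦ adj i j ⟧ (x≤xᵤ j)))
                (≤-reflexive (sym (*-distribʳ-sum X (a i))))
              pointwise : ∀ i → far i * Ax i ≤ ⟦ beyond i ⟧ * degree i * X
              pointwise i = begin
                far i * Ax i
                  ≤⟨ *-monoʳ-≤ (0≤sum (λ j → 0≤* 0≤⟦ adj i j ⟧ (0≤x j))) (far≤beyond i) ⟩
                ⟦ beyond i ⟧ * Ax i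
                  ≤⟨ *-monoˡ-≤ 0≤⟦ beyond i ⟧ (Ax≤ i) ⟩
                ⟦ beyond i ⟧ * (degree i * X)
                  ≡⟨ *-assoc ⟦ beyond i ⟧ (degree i) X ⟨
                ⟦ beyond i ⟧ * degree i * X ∎

          -- Twice `centre-bound` is added to `near-bound` and `far-bound`. On the right, `S + Y`
          -- then occurs three times, twice from the centre and once from `near-bound`, so it
          -- cancels against the three copies of `S` and `Y` on the left.
          q²xᵤ≤ : q * q * x u + q * q * x u ≤
            sum degree * x u + ((N + q) + N + ((N + q) + N)) * e
          q²xᵤ≤ = +-cancelʳ-≤ (S + S + S + (Y + Y + Y)) (begin
            L + L + (S + S + S + (Y + Y + Y))
              ≤⟨ +-mono-≤ (+-mono-≤ centre-bound centre-bound) (+-mono-≤ near-bound far-bound) ⟩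
            ((d * X + (S + Y)) + (N + q) * e) + ((d * X + (S + Y)) + (N + q) * e)
              + (((P * X + (S + Y)) + N * e) + (B * X + N * e))
              ≡⟨ collect X S Y d P B N (N + q) e ⟩
            (d + ((d + P) + B)) * X + ((N + q) + N + ((N + q) + N)) * e + (S + S + S + (Y + Y + Y))
              ≤⟨ +-monoˡ-≤ (S + S + S + (Y + Y + Y)) (+-monoˡ-≤ (((N + q) + N + ((N + q) + N)) * e)
                   (*-monoʳ-≤ (0≤x u) degrees-≥)) ⟩
            sum degree * X + ((N + q) + N + ((N + q) + N)) * e + (S + S + S + (Y + Y + Y)) ∎)
            where
            open ≤-Reasoning
            L = q * q * X
            collect : ∀ X S Y d P B N M e →
              ((d * X + (S + Y)) + M * e) + ((d * X + (S + Y)) + M * e)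
                + (((P * X + (S + Y)) + N * e) + (B * X + N * e))
              ≡ (d + ((d + P) + B)) * X + (M + N + (M + N)) * e + (S + S + S + (Y + Y + Y))
            collect = solve 9 (λ X S Y d P B N M e →
              ((d :* X :+ (S :+ Y)) :+ M :* e) :+ ((d :* X :+ (S :+ Y)) :+ M :* e)
                :+ (((P :* X :+ (S :+ Y)) :+ N :* e) :+ (B :* X :+ N :* e))
              := (d :+ ((d :+ P) :+ B)) :* X :+ (M :+ N :+ (M :+ N)) :* e
                :+ (S :+ S :+ S :+ (Y :+ Y :+ Y))) refl
              where open +-*-Solver

-- From statements about reals to estimates on late rational terms.

module CauchyReals where
  open import Data.Bool.Base using (true; false; if_then_else_)
  open import Data.Fin.Base using (Fin; zero; suc)
  open import Data.Nat.Base as ℕ using (ℕ; zero; suc; _⊔_)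
  import Data.Nat.Properties as ℕ
  open import Data.Product.Base using (_×_; _,_; ∃-syntax; proj₁; proj₂)
  open import Data.Rational.Base hiding (_⊔_)
  open import Data.Rational.Properties
  open import Data.Rational.Solver using (module +-*-Solver)
  open import Data.Sum.Base using (inj₁; inj₂)
  open import Data.Vec.Functional using (Vector)
  open import Defs using (ℝ; seq; cauchy; 0ℝ; 1ℝ; fromℕ; ∑; IsSqrt)
  import Defs as ℝ
  open import Relation.Binary.PropositionalEquality
  open import Relation.Nullary.Decidable.Core using (yes; no)
  open import Relation.Nullary.Negation.Core using (¬_; contradiction)
  open RationalSums

  p≤∣p∣ : ∀ p → p ≤ ∣ p ∣
  p≤∣p∣ p with ≤-total 0ℚ p
  ... | inj₁ 0≤p = ≤-reflexive (sym (0≤p⇒∣p∣≡p 0≤p))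
  ... | inj₂ p≤0 = ≤-trans p≤0 (0≤∣p∣ p)

  ∣p-q∣≡∣q-p∣ : ∀ p q → ∣ p - q ∣ ≡ ∣ q - p ∣
  ∣p-q∣≡∣q-p∣ p q = trans (cong ∣_∣ (flip p q)) (∣-p∣≡∣p∣ (q - p))
    where
    open +-*-Solver
    flip : ∀ p q → p - q ≡ - (q - p)
    flip = solve 2 (λ p q → p :- q := :- (q :- p)) refl

  split-difference : ∀ p q → p ≡ q + (p - q)
  split-difference = solve 2 (λ p q → p := q :+ (p :- q)) refl
    where open +-*-Solver

  ∣p-q∣≤r⇒p≤q+r : ∀ p q {r} → ∣ p - q ∣ ≤ r → p ≤ q + r
  ∣p-q∣≤r⇒p≤q+r p q {r} ∣p-q∣≤r = begin
    p             ≡⟨ split-difference p q ⟩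
    q + (p - q)   ≤⟨ +-monoʳ-≤ q (≤-trans (p≤∣p∣ (p - q)) ∣p-q∣≤r) ⟩
    q + r         ∎
    where open ≤-Reasoning

  ∣p-q∣≤r⇒∣p∣≤∣q∣+r : ∀ {p q r} → ∣ p - q ∣ ≤ r → ∣ p ∣ ≤ ∣ q ∣ + r
  ∣p-q∣≤r⇒∣p∣≤∣q∣+r {p} {q} {r} ∣p-q∣≤r = begin
    ∣ p ∣               ≡⟨ cong ∣_∣ (split-difference p q) ⟩
    ∣ q + (p - q) ∣     ≤⟨ ∣p+q∣≤∣p∣+∣q∣ q (p - q) ⟩
    ∣ q ∣ + ∣ p - q ∣   ≤⟨ +-monoʳ-≤ ∣ q ∣ ∣p-q∣≤r ⟩
    ∣ q ∣ + r           ∎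
    where open ≤-Reasoning

  ∣sum∣≤sum∣∣ : ∀ {n} (f : Fin n → ℚ) → ∣ sum f ∣ ≤ sum (λ i → ∣ f i ∣)
  ∣sum∣≤sum∣∣ {zero}  f = ≤-refl
  ∣sum∣≤sum∣∣ {suc n} f = ≤-trans
    (∣p+q∣≤∣p∣+∣q∣ (f zero) (sum (λ i → f (suc i))))
    (+-monoʳ-≤ ∣ f zero ∣ (∣sum∣≤sum∣∣ (λ i → f (suc i))))

  0<* : ∀ {p q} → 0ℚ < p → 0ℚ < q → 0ℚ < p * q
  0<* {p} {q} 0<p 0<q = positive⁻¹ (p * q) {{pos*pos⇒pos p {{positive 0<p}} q {{positive 0<q}}}}

  divide : ∀ c p → 0ℚ < c → 0ℚ < p → ∃[ e ] 0ℚ < e × c * e ≡ p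
  divide c p 0<c 0<p = 1/ c * p ,
    0<* (positive⁻¹ (1/ c) {{1/pos⇒pos c}}) 0<p ,
    trans (sym (*-assoc c (1/ c) p)) (trans (cong (_* p) (*-inverseʳ c)) (*-identityˡ p))
    where
    instance
      c-positive : Positive c
      c-positive = positive 0<c

      c-nonZero : NonZero c
      c-nonZero = pos⇒nonZero c

  halve : ∀ ε → 0ℚ < ε → ∃[ δ ] 0ℚ < δ × δ + δ ≡ ε
  halve ε 0<ε = ½ * ε , 0<* (positive⁻¹ ½) 0<ε ,
    trans (sym (*-distribʳ-+ ε ½ ½)) (*-identityˡ ε)

  -- The order on reals is a negation, but comparison of rationals is decidable. If one late term
  -- were below `- ε`, the Cauchy bound `ε / 2` would keep all later terms below `- ε / 2`, making
  -- `s` negative.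
  0≤⇒eventually-≥ : ∀ s → 0ℝ ℝ.≤ s → ∀ ε → 0ℚ < ε →
    ∃[ N ] ∀ k → N ℕ.≤ k → 0ℚ ≤ seq s k + ε
  0≤⇒eventually-≥ s s≮0 ε 0<ε = N , bound
    where
    open ≤-Reasoning

    δ = proj₁ (halve ε 0<ε)
    0<δ = proj₁ (proj₂ (halve ε 0<ε))
    δ+δ≡ε = proj₂ (proj₂ (halve ε 0<ε))
    N = proj₁ (cauchy s δ 0<δ)

    bound : ∀ k → N ℕ.≤ k → 0ℚ ≤ seq s k + ε
    bound k N≤k with 0ℚ ≤? seq s k + ε
    ... | yes 0≤sₖ+ε = 0≤sₖ+ε
    ... | no 0≰sₖ+ε = contradiction (δ , 0<δ , k , below) s≮0
      where
      below : ∀ j → k ℕ.≤ j → seq s j + δ ≤ 0ℚ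
      below j k≤j = begin
        seq s j + δ
          ≤⟨ +-monoˡ-≤ δ (∣p-q∣≤r⇒p≤q+r (seq s j) (seq s k) (proj₂ (cauchy s δ 0<δ) j k (ℕ.≤-trans N≤k k≤j) N≤k)) ⟩
        seq s k + δ + δ
          ≡⟨ +-assoc (seq s k) δ δ ⟩
        seq s k + (δ + δ)
          ≡⟨ cong (seq s k +_) δ+δ≡ε ⟩
        seq s k + ε
          ≤⟨ <⇒≤ (≰⇒> 0≰sₖ+ε) ⟩
        0ℚ ∎

  -- An eigenvector is only known not to vanish everywhere, which yields no entry bounded away from
  -- zero. This lemma lets such a bound be assumed and refuted: a late term larger than `ε` in
  -- absolute value keeps all later ones at least `ε / 2`.
  ¬apart⇒≃0 : ∀ v → (∀ δ → 0ℚ < δ → ∀ N → ¬ (∀ k → N ℕ.≤ k → δ ≤ ∣ seq v k ∣)) → v ℝ.≃ 0ℝ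
  ¬apart⇒≃0 v ¬apart ε 0<ε = N , bound
    where
    open ≤-Reasoning

    δ = proj₁ (halve ε 0<ε)
    0<δ = proj₁ (proj₂ (halve ε 0<ε))
    δ+δ≡ε = proj₂ (proj₂ (halve ε 0<ε))
    N = proj₁ (cauchy v δ 0<δ)

    bound : ∀ k → N ℕ.≤ k → ∣ seq v k - 0ℚ ∣ ≤ ε
    bound k N≤k with ∣ seq v k - 0ℚ ∣ ≤? ε
    ... | yes ∣vₖ∣≤ε = ∣vₖ∣≤ε
    ... | no ∣vₖ∣≰ε = contradiction above (¬apart δ 0<δ k)
      where
      above : ∀ j → k ℕ.≤ j → δ ≤ ∣ seq v j ∣
      above j k≤j = +-cancelʳ-≤ δ (begin
        δ + δ               ≡⟨ δ+δ≡ε ⟩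
        ε                   ≤⟨ <⇒≤ (≰⇒> ∣vₖ∣≰ε) ⟩
        ∣ seq v k - 0ℚ ∣    ≡⟨ cong ∣_∣ (+-identityʳ (seq v k)) ⟩
        ∣ seq v k ∣         ≤⟨ ∣p-q∣≤r⇒∣p∣≤∣q∣+r (proj₂ (cauchy v δ 0<δ) k j N≤k (ℕ.≤-trans N≤k k≤j)) ⟩
        ∣ seq v j ∣ + δ     ∎)

  -- With η = 4h the gap between the square root s and μ, and k so large that
  -- s_k ≥ - h and s_k² ≥ m - h², the witness is q = s_k + 3h: q² ≥ m + 2h².
  separate : ∀ m s μ → IsSqrt (fromℕ m) s → s ℝ.< μ →
    ∃[ q ] 0ℚ ≤ q × ι m < q * q × ∃[ N ] ∀ k → N ℕ.≤ k → q ≤ seq μ k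
  separate m s μ (0≤s , s²≃m) (η , 0<η , N₁ , s+η≤μ) =
    let h , 0<h , 4h≡η = divide (ι 4) η (positive⁻¹ (ι 4)) 0<η
        0<h² = 0<* 0<h 0<h
        N₂ , 0≤s+h = 0≤⇒eventually-≥ s 0≤s h 0<h
        N₃ , s²≈m = s²≃m (h * h) 0<h²
        N₄ , s≈s = cauchy s h 0<h
        K = N₂ ⊔ (N₃ ⊔ N₄)
        t = seq s K
        q = t + (h + h + h)
        K≥N₂ = ℕ.m≤m⊔n N₂ (N₃ ⊔ N₄)
        K≥N₃ = ℕ.≤-trans (ℕ.m≤m⊔n N₃ N₄) (ℕ.m≤n⊔m N₂ (N₃ ⊔ N₄))
        K≥N₄ = ℕ.≤-trans (ℕ.m≤n⊔m N₃ N₄) (ℕ.m≤n⊔m N₂ (N₃ ⊔ N₄))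
        0≤h = <⇒≤ 0<h
        0≤t+h = 0≤s+h K K≥N₂
        0≤q = ≤-trans 0≤t+h (+-monoʳ-≤ t (≤-trans (p≤p+q 0≤h) (p≤p+q 0≤h)))
        m≤t²+h² = ∣p-q∣≤r⇒p≤q+r (ι m) (t * t) (subst (_≤ h * h) (∣p-q∣≡∣q-p∣ (t * t) (ι m)) (s²≈m K K≥N₃))
        0≤6h = 0≤* (0≤ι 6) 0≤h
    in q , 0≤q ,
       (begin-strict
         ι m                                                 ≤⟨ m≤t²+h² ⟩
         t * t + h * h                                       ≤⟨ p≤p+q (0≤* 0≤6h 0≤t+h) ⟩
         t * t + h * h + ι 6 * h * (t + h)                   <⟨ p<p+q _ 0<h² ⟩
         t * t + h * h + ι 6 * h * (t + h) + h * h           ≤⟨ p≤p+q (<⇒≤ 0<h²) ⟩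
         t * t + h * h + ι 6 * h * (t + h) + h * h + h * h   ≡⟨ expand t h ⟩
         q * q                                               ∎) ,
       N₁ ⊔ N₄ , λ k N≤k →
       begin
         q                           ≤⟨ +-monoˡ-≤ (h + h + h) (∣p-q∣≤r⇒p≤q+r t (seq s k)
                                          (s≈s K k K≥N₄ (ℕ.≤-trans (ℕ.m≤n⊔m N₁ N₄) N≤k))) ⟩
         seq s k + h + (h + h + h)   ≡⟨ gather (seq s k) h ⟩
         seq s k + ι 4 * h           ≡⟨ cong (seq s k +_) 4h≡η ⟩
         seq s k + η                 ≤⟨ s+η≤μ k (ℕ.≤-trans (ℕ.m≤m⊔n N₁ N₄) N≤k) ⟩
         seq μ k                     ∎
    where
    open ≤-Reasoning
    open +-*-Solver

    p<p+q : ∀ p {q} → 0ℚ < q → p < p + q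
    p<p+q p {q} 0<q = subst (_< p + q) (+-identityʳ p) (+-monoʳ-< p 0<q)

    expand : ∀ t h → t * t + h * h + ι 6 * h * (t + h) + h * h + h * h ≡
                     (t + (h + h + h)) * (t + (h + h + h))
    expand = solve 2 (λ t h →
      t :* t :+ h :* h :+ con (ι 6) :* h :* (t :+ h) :+ h :* h :+ h :* h :=
      (t :+ (h :+ h :+ h)) :* (t :+ (h :+ h :+ h))) refl

    gather : ∀ s h → s + h + (h + h + h) ≡ s + ι 4 * h
    gather = solve 2 (λ s h → s :+ h :+ (h :+ h :+ h) :=
      s :+ con (ι 4) :* h) refl

  seq-∑ : ∀ {n} (f : Vector ℝ n) k → seq (∑ f) k ≡ sum (λ i → seq (f i) k)
  seq-∑ {zero}  f k = refl
  seq-∑ {suc n} f k = cong (seq (f zero) k +_) (seq-∑ (λ i → f (suc i)) k)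

  seq-⟦⟧ : ∀ b k → seq (if b then 1ℝ else 0ℝ) k ≡ ⟦ b ⟧
  seq-⟦⟧ true  k = refl
  seq-⟦⟧ false k = refl

-- The bound on eigenvalues of a graph without 4-cycles.

module SpectralRadius where
  open import Data.Fin.Base using (Fin)
  open import Data.List.Base using (allFin)
  import Data.List.Extrema as Extrema
  open import Data.List.Membership.Propositional.Properties using (∈-allFin)
  open import Data.List.Relation.Unary.All using (lookup)
  open import Data.Nat.Base as ℕ using (ℕ; _⊔_)
  import Data.Nat.Properties as ℕ
  open import Data.Product.Base using (_,_; ∃-syntax; proj₁; proj₂)
  open import Data.Rational.Base hiding (_⊔_)
  open import Data.Rational.Properties
  open import Data.Rational.Solver using (module +-*-Solver)
  open import Defs using (Graph; ℝ; seq; fromℕ; numEdges; Has4Cycle; adjacencyMatrix; IsEigenvalue; IsSqrt; ∑)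
  import Defs as ℝ
  open import Relation.Binary.Bundles using (DecTotalOrder; TotalOrder)
  open import Relation.Binary.PropositionalEquality
  open import Relation.Nullary.Decidable.Core using (yes; no)
  open import Relation.Nullary.Negation.Core using (¬_; contradiction)
  open RationalSums
  open CauchyReals
  open C₄Free

  -- The vertex passed in is the default of `argmax` and witnesses that there is something to
  -- maximise over. The lemma serves both for the largest entry of a vector and for the largest of
  -- finitely many moduli.
  argmax-allFin : ∀ {c ℓ₁ ℓ₂} (O : TotalOrder c ℓ₁ ℓ₂) {n} → Fin n →
    (f : Fin n → TotalOrder.Carrier O) → ∃[ u ] ∀ i → TotalOrder._≤_ O (f i) (f u)
  argmax-allFin O {n} ⊥ f = argmax f ⊥ (allFin n) , λ i → lookup (f[xs]≤f[argmax] ⊥ (allFin n)) (∈-allFin i)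
    where open Extrema O

  -- This is where `9 ≤ m` enters: `q` below 3 would give `q * q ≤ 9 ≤ m`. The result supplies the
  -- factor three in `near-bound` and `far-bound`.
  9≤m<q²⇒3≤q : ∀ {m q} → 9 ℕ.≤ m → 0ℚ ≤ q → ι m < q * q → ι 3 ≤ q
  9≤m<q²⇒3≤q {m} {q} 9≤m 0≤q m<q² with ι 3 ≤? q
  ... | yes 3≤q = 3≤q
  ... | no 3≰q = contradiction (<-≤-trans m<q² (begin
    q * q                 ≤⟨ *-monoˡ-≤ 0≤q q≤3 ⟩
    q * ι 3               ≤⟨ *-monoʳ-≤ (0≤ι 3) q≤3 ⟩
    ι 9                   ≤⟨ p≤p+q (0≤ι (m ℕ.∸ 9)) ⟩
    ι 9 + ι (m ℕ.∸ 9)     ≡⟨ ι-+ 9 (m ℕ.∸ 9) ⟨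
    ι (9 ℕ.+ (m ℕ.∸ 9))   ≡⟨ cong ι (ℕ.m+[n∸m]≡n 9≤m) ⟩
    ι m                   ∎)) (<-irrefl refl)
    where
    open ≤-Reasoning
    q≤3 : q ≤ ι 3
    q≤3 = <⇒≤ (≰⇒> 3≰q)

  p+p≤q+q⇒p≤q : ∀ {p q} → p + p ≤ q + q → p ≤ q
  p+p≤q+q⇒p≤q {p} {q} 2p≤2q with p ≤? q
  ... | yes p≤q = p≤q
  ... | no p≰q = contradiction 2p≤2q λ 2p≤2q →
    <-irrefl refl (≤-<-trans 2p≤2q (+-mono-< (≰⇒> p≰q) (≰⇒> p≰q)))

  module _ {n} (G : Graph n) where

    -- Passing to absolute values loses the eigenvalue equation but keeps an inequality in the right
    -- direction, by the triangle inequality and the nonnegativity of the matrix. No sign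
    -- information on the eigenvector is required.
    sub-eigenvector : ∀ (v : Fin n → ℝ) μ k q e → q ≤ seq μ k → ∀ i →
      ∣ seq (∑ (λ j → adjacencyMatrix G i j ℝ.* v j)) k - seq μ k * seq (v i) k ∣ ≤ e →
      q * ∣ seq (v i) k ∣ ≤ sum (λ j → a G i j * ∣ seq (v j) k ∣) + e
    sub-eigenvector v μ k q e q≤μ i Av≈μv = begin
      q * ∣ x i ∣
        ≤⟨ *-monoʳ-≤ (0≤∣p∣ (x i)) (≤-trans q≤μ (p≤∣p∣ (seq μ k))) ⟩
      ∣ seq μ k ∣ * ∣ x i ∣
        ≡⟨ ∣p*q∣≡∣p∣*∣q∣ (seq μ k) (x i) ⟨
      ∣ seq μ k * x i ∣
        ≤⟨ ∣p-q∣≤r⇒∣p∣≤∣q∣+r (subst (_≤ e) (∣p-q∣≡∣q-p∣ Av (seq μ k * x i)) Av≈μv) ⟩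
      ∣ Av ∣ + e
        ≡⟨ cong (λ y → ∣ y ∣ + e) (trans
             (seq-∑ (λ j → adjacencyMatrix G i j ℝ.* v j) k)
             (sum-cong-≗ (λ j → cong (_* x j) (seq-⟦⟧ (Graph.adj G i j) k)))) ⟩
      ∣ sum (λ j → a G i j * x j) ∣ + e
        ≤⟨ +-monoˡ-≤ e (∣sum∣≤sum∣∣ (λ j → a G i j * x j)) ⟩
      sum (λ j → ∣ a G i j * x j ∣) + e
        ≡⟨ cong (_+ e) (sum-cong-≗ (λ j → trans
             (∣p*q∣≡∣p∣*∣q∣ (a G i j) (x j))
             (cong (_* ∣ x j ∣) (0≤p⇒∣p∣≡p 0≤⟦ Graph.adj G i j ⟧)))) ⟩
      sum (λ j → a G i j * ∣ x j ∣) + e ∎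
      where
      open ≤-Reasoning
      x : Fin n → ℚ
      x j = seq (v j) k
      Av = seq (∑ (λ j → adjacencyMatrix G i j ℝ.* v j)) k

    q²xᵤ≤mxᵤ+Ke : ¬ Has4Cycle G → ∀ (x : Fin n → ℚ) u q e →
      (∀ i → 0ℚ ≤ x i) → (∀ i → x i ≤ x u) → ι 3 ≤ q → 0ℚ ≤ e →
      (∀ i → q * x i ≤ sum (λ j → a G i j * x j) + e) →
      q * q * x u ≤ ι (numEdges G) * x u + (sum {n} (λ _ → 1ℚ) + q + sum {n} (λ _ → 1ℚ)) * e
    q²xᵤ≤mxᵤ+Ke noC₄ x u q e 0≤x x≤xᵤ 3≤q 0≤e sub = p+p≤q+q⇒p≤q (begin
      q * q * x u + q * q * x u
        ≤⟨ q²xᵤ≤ G u noC₄ x 0≤x x≤xᵤ q e 3≤q 0≤e sub ⟩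
      sum (degree G) * x u + (K + K) * e
        ≡⟨ cong (λ s → s * x u + (K + K) * e) (handshake G) ⟨
      (m + m) * x u + (K + K) * e
        ≡⟨ regroup m (x u) K e ⟩
      (m * x u + K * e) + (m * x u + K * e) ∎)
      where
      open ≤-Reasoning
      m = ι (numEdges G)
      K = sum {n} (λ _ → 1ℚ) + q + sum {n} (λ _ → 1ℚ)
      regroup : ∀ m x K e → (m + m) * x + (K + K) * e ≡ (m * x + K * e) + (m * x + K * e)
      regroup = solve 4 (λ m x K e →
        (m :+ m) :* x :+ (K :+ K) :* e := (m :* x :+ K :* e) :+ (m :* x :+ K :* e)) refl
        where open +-*-Solver

    C₄-free⇒μ≯√m : 9 ℕ.≤ numEdges G → ¬ Has4Cycle G → ∀ μ s → IsEigenvalue (adjacencyMatrix G) μ →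
      IsSqrt (fromℕ (numEdges G)) s → ¬ (s ℝ.< μ)
    C₄-free⇒μ≯√m 9≤m noC₄ μ s (v , v≄0 , Av≃μv) s-sqrt s<μ =
      -- Every entry is shown to be zero, by refuting that it eventually stays at distance `δ` from
      -- zero.
      v≄0 (λ i → ¬apart⇒≃0 (v i) (¬apart i))
      where
      open ≤-Reasoning

      m N : ℚ
      m = ι (numEdges G)
      N = sum {n} (λ _ → 1ℚ)

      ¬apart : ∀ i δ → 0ℚ < δ → ∀ N₀ → ¬ (∀ k → N₀ ℕ.≤ k → δ ≤ ∣ seq (v i) k ∣)
      ¬apart i δ 0<δ N₀ δ≤∣v∣ =
        let q , 0≤q , m<q² , N₁ , q≤μ = separate (numEdges G) s μ s-sqrt s<μ
            0≤N = 0≤sum {n} (λ _ → 0≤1)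
            K = N + q + N
            0≤K = +-mono-≤ (+-mono-≤ 0≤N 0≤q) 0≤N
            gap = q * q - m
            0<gap = subst (_< gap) (+-inverseʳ m) (+-monoˡ-< (- m) m<q²)
            -- `K * e` is the total error in the upper bound. The additional `e` makes the final
            -- comparison strict.
            e , 0<e , [1+K]e≡gap*δ = divide (1ℚ + K) (gap * δ) (+-mono-<-≤ (positive⁻¹ 1ℚ) 0≤K) (0<* 0<gap 0<δ)
            modulus = λ j → proj₁ (Av≃μv j e 0<e)
            -- Each coordinate of the eigenvalue equation has its own modulus; beyond the largest
            -- one all coordinates are accurate to within `e`.
            j₀ , modulus≤ = argmax-allFin ℕ.≤-totalOrder i modulus
            k = N₀ ⊔ (N₁ ⊔ modulus j₀)
            k≥N₀ = ℕ.m≤m⊔n N₀ (N₁ ⊔ modulus j₀)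
            k≥N₁ = ℕ.≤-trans (ℕ.m≤m⊔n N₁ (modulus j₀)) (ℕ.m≤n⊔m N₀ (N₁ ⊔ modulus j₀))
            k≥modulus = λ j → ℕ.≤-trans (modulus≤ j)
              (ℕ.≤-trans (ℕ.m≤n⊔m N₁ (modulus j₀)) (ℕ.m≤n⊔m N₀ (N₁ ⊔ modulus j₀)))
            x = λ j → ∣ seq (v j) k ∣
            -- The maximal entry is chosen among the rational terms at the fixed index `k`, so no
            -- comparison of reals has to be decided. It is at least `δ`, since the entry at `i` is.
            u , x≤xᵤ = argmax-allFin (DecTotalOrder.totalOrder ≤-decTotalOrder) i x
            upper = q²xᵤ≤mxᵤ+Ke noC₄ x u q e (λ j → 0≤∣p∣ (seq (v j) k)) x≤xᵤ
              (9≤m<q²⇒3≤q 9≤m 0≤q m<q²) (<⇒≤ 0<e)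
              (λ j → sub-eigenvector v μ k q e (q≤μ k k≥N₁) j (proj₂ (Av≃μv j e 0<e) k (k≥modulus j)))
        in <-irrefl refl (begin-strict
          m * x u + K * e          ≡⟨ +-identityˡ (m * x u + K * e) ⟨
          0ℚ + (m * x u + K * e)   <⟨ +-monoˡ-< (m * x u + K * e) 0<e ⟩
          e + (m * x u + K * e)    ≡⟨ regroup e m (x u) K ⟩
          m * x u + (1ℚ + K) * e   ≡⟨ cong (m * x u +_) [1+K]e≡gap*δ ⟩
          m * x u + gap * δ        ≤⟨ +-monoʳ-≤ (m * x u)
                                        (*-monoˡ-≤ (<⇒≤ 0<gap) (≤-trans (δ≤∣v∣ k k≥N₀) (x≤xᵤ i))) ⟩
          m * x u + gap * x u      ≡⟨ expand m (x u) q ⟩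
          q * q * x u              ≤⟨ upper ⟩
          m * x u + K * e          ∎)
        where
        open +-*-Solver
        regroup : ∀ e m x K → e + (m * x + K * e) ≡ m * x + (1ℚ + K) * e
        regroup = solve 4 (λ e m x K → e :+ (m :* x :+ K :* e) := m :* x :+ (con 1ℚ :+ K) :* e) refl
        expand : ∀ m x q → m * x + (q * q - m) * x ≡ q * q * x
        expand = solve 3 (λ m x q → m :* x :+ (q :* q :- m) :* x := q :* q :* x) refl

open import Defs
open import Data.Nat.Base using (ℕ; _≥_)
open import Data.Product.Base using (_,_)
open import Relation.Binary.PropositionalEquality using (_≡_; refl)
open import Relation.Nullary.Decidable using (decidable-stable)

theorem2 : ∀ (m : ℕ) → m ≥ 9 →
    ∀ (n : ℕ) (G : Graph n) → numEdges G ≡ m →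
    ∀ (μ √m : ℝ) → IsSpectralRadius G μ → IsSqrt (fromℕ m) √m →
    √m < μ → Has4Cycle G
theorem2 m m≥9 n G refl μ √m (μ-eigenvalue , _) √m-sqrt √m<μ = decidable-stable (C₄Free.has4Cycle? G) λ noC₄ →
  SpectralRadius.C₄-free⇒μ≯√m G m≥9 noC₄ μ √m μ-eigenvalue √m-sqrt √m<μ
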